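{- Let $k\ge2$, let $\alpha$ be a simple ordered rational $k$-cone in $\mathbb{R}^n$, and let $s\in S_k$ be a transposition. Then $$\operatorname{lsin}_k\alpha=\operatorname{lsin}_k\alpha_s .$$
   Context: An ordered rational $k$-cone $\alpha$ in $\mathbb{R}^n$ ($k\le n$) is given by a vertex $A_0\in\mathbb{Z}^n$ and an ordered tuple $(v_1,\ldots,v_k)$ of linearly independent primitive integer vectors (its edge vectors); as a set it is $\{A_0+\sum\lambda_iv_i:\lambda_i\ge0\}$. Let $\Gamma=\mathbb{Z}^n\cap\operatorname{span}_{\mathbb{R}}(v_1,\ldots,v_k)$. There is a unique $\mathbb{Z}$-basis $e_1,\ldots,e_k$ of $\Gamma$ such that $v_i=\sum_{j\le i}a_{j,i}e_j$ with $a_{i,i}>0$ and $0\le a_{j,i}<a_{i,i}$ for $j<i$. The $i$-th integer sine is $\operatorname{lsin}_i\alpha=a_{i,i}$. The integer sine of a rational $m$-cone $\beta$ with primitive edge vectors $w_1,\ldots,w_m$ is the index $\operatorname{lsin}(\beta)=[\mathbb{Z}^n\cap\operatorname{span}_{\mathbb{R}}(w_1,\ldots,w_m):\mathbb{Z}w_1+\cdots+\mathbb{Z}w_m]$. The cone $\alpha$ is simple if every $(k-1)$-dimensional face $\beta$ of $\alpha$ (the cone with vertex $A_0$ generated by $k-1$ of the vectors $v_i$) satisfies $\operatorname{lsin}(\beta)=1$. For $s\in S_k$, $\alpha_s$ denotes the $s$-transpose of $\alpha$: the cone with the same vertex and with ordered edge vectors $(v_{s(1)},\ldots,v_{s(k)})$.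 -}

module Defs where

open import Algebra.Bundles using (CommutativeMonoid)
open import Data.Fin.Base as Fin using (Fin; punchIn)
open import Data.Fin.Permutation as Perm
  using (Permutation′; _⟨$⟩ʳ_; _⟨$⟩ˡ_; inverseˡ)
open import Data.Integer.Base as ℤ using (ℤ; +_)
open import Data.Integer.Divisibility as ℤ using ()
import Data.Integer.Properties as ℤ
open import Data.Nat.Base as ℕ using (ℕ; zero; suc)
import Data.Nat.Properties as ℕ
open import Data.Product using (∃₂; ∃-syntax; _×_; _,_)
open import Data.Rational.Base as ℚ using (ℚ; 0ℚ; 1ℚ; ½; ∣_∣)
import Data.Rational.Properties as ℚ
open import Data.Rational.Solver using (module +-*-Solver)
open import Data.Vec.Functional using (Vector; insertAt; removeAt)
open import Data.Vec.Functional.Properties using (insertAt-lookup; insertAt-punchIn)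
open import Function.Base using (_∘_)
open import Level using (0ℓ)
open import Relation.Binary.Definitions using (Reflexive; Symmetric; Transitive)
open import Relation.Binary.PropositionalEquality
  using (_≡_; _≢_; refl; sym; trans; cong; cong₂; subst)
open import Relation.Unary using (Pred; _∈_)

import Algebra.Properties.CommutativeMonoid.Sum as Sum

------------------------------------------------------------------------
-- Real numbers, as Cauchy sequences of rationals.  Eta is switched off
-- because comparing Cauchy proofs makes conversion checking explode.

infix  4 _≈_
infixl 6 _+_
infixl 7 _·_

record ℝ : Set where
  no-eta-equality
  field
    seq    : ℕ → ℚ
    cauchy : ∀ ε → 0ℚ ℚ.< ε → ∃[ N ] ∀ m n → N ℕ.≤ m → N ℕ.≤ n →
             ∣ seq m ℚ.- seq n ∣ ℚ.< ε

open ℝ public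

record _≈_ (x y : ℝ) : Set where
  no-eta-equality
  constructor mk≈
  field
    close : ∀ ε → 0ℚ ℚ.< ε → ∃[ N ] ∀ n → N ℕ.≤ n →
            ∣ seq x n ℚ.- seq y n ∣ ℚ.< ε

open _≈_ public

private
  0<½* : ∀ {ε} → 0ℚ ℚ.< ε → 0ℚ ℚ.< ½ ℚ.* ε
  0<½* {ε} 0<ε = subst (ℚ._< ½ ℚ.* ε) (ℚ.*-zeroʳ ½) (ℚ.*-monoʳ-<-pos ½ 0<ε)

  ½+½ : ∀ ε → ½ ℚ.* ε ℚ.+ ½ ℚ.* ε ≡ ε
  ½+½ ε = trans (sym (ℚ.*-distribʳ-+ ε ½ ½)) (ℚ.*-identityˡ ε)

  ∣+∣< : ∀ {ε} p q r → r ≡ p ℚ.+ q → ∣ p ∣ ℚ.< ½ ℚ.* ε → ∣ q ∣ ℚ.< ½ ℚ.* ε → ∣ r ∣ ℚ.< ε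
  ∣+∣< {ε} p q _ refl p< q< =
    subst (∣ p ℚ.+ q ∣ ℚ.<_) (½+½ ε)
      (ℚ.≤-<-trans (ℚ.∣p+q∣≤∣p∣+∣q∣ p q) (ℚ.+-mono-< p< q<))

  interchange : ∀ a b c d → (a ℚ.+ b) ℚ.- (c ℚ.+ d) ≡ (a ℚ.- c) ℚ.+ (b ℚ.- d)
  interchange = solve 4 (λ a b c d → (a :+ b) :- (c :+ d) := (a :- c) :+ (b :- d)) refl
    where open +-*-Solver

  telescope : ∀ a b c → a ℚ.- c ≡ (a ℚ.- b) ℚ.+ (b ℚ.- c)
  telescope = solve 3 (λ a b c → a :- c := (a :- b) :+ (b :- c)) refl
    where open +-*-Solver

  *-distrib-minus : ∀ q a b → a ℚ.* q ℚ.- b ℚ.* q ≡ (a ℚ.- b) ℚ.* q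
  *-distrib-minus = solve 3 (λ q a b → a :* q :- b :* q := (a :- b) :* q) refl
    where open +-*-Solver

  ∣-∣-comm : ∀ a b → ∣ a ℚ.- b ∣ ≡ ∣ b ℚ.- a ∣
  ∣-∣-comm a b = trans (sym (ℚ.∣-p∣≡∣p∣ (a ℚ.- b))) (cong ∣_∣ (flip a b))
    where
    open +-*-Solver
    flip : ∀ a b → ℚ.- (a ℚ.- b) ≡ b ℚ.- a
    flip = solve 2 (λ a b → :- (a :- b) := b :- a) refl

  -- A factor δ > 0 by which a tolerance has to be shrunk to survive
  -- multiplication by q, namely δ = 1 / (1 + ∣q∣).
  shrink : ∀ q → ∃[ δ ] (0ℚ ℚ.< δ × (∀ ε → 0ℚ ℚ.< ε → ∀ p → ∣ p ∣ ℚ.< ε ℚ.* δ → ∣ p ℚ.* q ∣ ℚ.< ε))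
  shrink q = δ , ℚ.positive⁻¹ δ , bound
    where
    b = 1ℚ ℚ.+ ∣ q ∣
    0<b : 0ℚ ℚ.< b
    0<b = ℚ.<-≤-trans (ℚ.positive⁻¹ 1ℚ)
            (subst (ℚ._≤ b) (ℚ.+-identityʳ 1ℚ) (ℚ.+-monoʳ-≤ 1ℚ (ℚ.0≤∣p∣ q)))
    ∣q∣≤b : ∣ q ∣ ℚ.≤ b
    ∣q∣≤b = subst (ℚ._≤ b) (ℚ.+-identityˡ ∣ q ∣)
              (ℚ.+-monoˡ-≤ ∣ q ∣ (ℚ.<⇒≤ (ℚ.positive⁻¹ 1ℚ)))
    instance
      b-pos : ℚ.Positive b
      b-pos = ℚ.positive 0<b
      b-nonZero : ℚ.NonZero b
      b-nonZero = ℚ.pos⇒nonZero b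
    δ = ℚ.1/ b
    instance
      δ-pos : ℚ.Positive δ
      δ-pos = ℚ.1/pos⇒pos b
    bound : ∀ ε → 0ℚ ℚ.< ε → ∀ p → ∣ p ∣ ℚ.< ε ℚ.* δ → ∣ p ℚ.* q ∣ ℚ.< ε
    bound ε 0<ε p p< = begin-strict
      ∣ p ℚ.* q ∣         ≡⟨ ℚ.∣p*q∣≡∣p∣*∣q∣ p q ⟩
      ∣ p ∣ ℚ.* ∣ q ∣     ≤⟨ ℚ.*-monoˡ-≤-nonNeg ∣ p ∣ ⦃ ℚ.∣-∣-nonNeg p ⦄ ∣q∣≤b ⟩
      ∣ p ∣ ℚ.* b         <⟨ ℚ.*-monoˡ-<-pos b p< ⟩
      ε ℚ.* δ ℚ.* b       ≡⟨ ℚ.*-assoc ε δ b ⟩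
      ε ℚ.* (δ ℚ.* b)     ≡⟨ cong (ε ℚ.*_) (ℚ.*-inverseˡ b) ⟩
      ε ℚ.* 1ℚ            ≡⟨ ℚ.*-identityʳ ε ⟩
      ε                   ∎
      where open ℚ.≤-Reasoning

  0<* : ∀ {p q} → 0ℚ ℚ.< p → 0ℚ ℚ.< q → 0ℚ ℚ.< p ℚ.* q
  0<* {p} {q} 0<p 0<q =
    subst (ℚ._< p ℚ.* q) (ℚ.*-zeroʳ p) (ℚ.*-monoʳ-<-pos p ⦃ ℚ.positive 0<p ⦄ 0<q)

fromℚ : ℚ → ℝ
fromℚ q .seq _            = q
fromℚ q .cauchy ε 0<ε     = 0 , λ _ _ _ _ →
  subst (λ d → ∣ d ∣ ℚ.< ε) (sym (ℚ.+-inverseʳ q)) 0<ε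

fromℤ : ℤ → ℝ
fromℤ z = fromℚ (z ℚ./ 1)

0ℝ : ℝ
0ℝ = fromℚ 0ℚ

_+_ : ℝ → ℝ → ℝ
(x + y) .seq n        = seq x n ℚ.+ seq y n
(x + y) .cauchy ε 0<ε =
  let M , p = cauchy x (½ ℚ.* ε) (0<½* 0<ε)
      N , q = cauchy y (½ ℚ.* ε) (0<½* 0<ε)
  in M ℕ.⊔ N , λ m n m≥ n≥ →
    ∣+∣< (seq x m ℚ.- seq x n) (seq y m ℚ.- seq y n) _
      (interchange (seq x m) (seq y m) (seq x n) (seq y n))
      (p m n (ℕ.m⊔n≤o⇒m≤o M N m≥) (ℕ.m⊔n≤o⇒m≤o M N n≥))
      (q m n (ℕ.m⊔n≤o⇒n≤o M N m≥) (ℕ.m⊔n≤o⇒n≤o M N n≥))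

-- Multiplication of a real number by an integer: integer vectors are the
-- only vectors whose real linear combinations are needed.
_·_ : ℝ → ℤ → ℝ
(x · z) .seq n        = seq x n ℚ.* (z ℚ./ 1)
(x · z) .cauchy ε 0<ε =
  let δ , 0<δ , bound = shrink (z ℚ./ 1)
      N , p           = cauchy x (ε ℚ.* δ) (0<* 0<ε 0<δ)
  in N , λ m n m≥ n≥ →
    subst (λ d → ∣ d ∣ ℚ.< ε) (sym (*-distrib-minus (z ℚ./ 1) (seq x m) (seq x n)))
      (bound ε 0<ε (seq x m ℚ.- seq x n) (p m n m≥ n≥))

≗⇒≈ : ∀ {x y} → (∀ n → seq x n ≡ seq y n) → x ≈ y
≗⇒≈ {x} {y} eq .close ε 0<ε = 0 , λ n _ →
  subst (λ d → ∣ d ∣ ℚ.< ε)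
    (sym (trans (cong (ℚ._- seq y n) (eq n)) (ℚ.+-inverseʳ (seq y n)))) 0<ε

≈-refl : Reflexive _≈_
≈-refl = ≗⇒≈ λ _ → refl

≈-sym : Symmetric _≈_
≈-sym {x} {y} x≈y .close ε 0<ε = let N , p = close x≈y ε 0<ε in N , λ n n≥ →
  subst (ℚ._< ε) (∣-∣-comm (seq x n) (seq y n)) (p n n≥)

≈-trans : Transitive _≈_
≈-trans {x} {y} {z} x≈y y≈z .close ε 0<ε =
  let M , p = close x≈y (½ ℚ.* ε) (0<½* 0<ε)
      N , q = close y≈z (½ ℚ.* ε) (0<½* 0<ε)
  in M ℕ.⊔ N , λ n n≥ →
    ∣+∣< (seq x n ℚ.- seq y n) (seq y n ℚ.- seq z n) _
      (telescope (seq x n) (seq y n) (seq z n))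
      (p n (ℕ.m⊔n≤o⇒m≤o M N n≥)) (q n (ℕ.m⊔n≤o⇒n≤o M N n≥))

+-cong : ∀ {x y u v} → x ≈ y → u ≈ v → x + u ≈ y + v
+-cong {x} {y} {u} {v} x≈y u≈v .close ε 0<ε =
  let M , p = close x≈y (½ ℚ.* ε) (0<½* 0<ε)
      N , q = close u≈v (½ ℚ.* ε) (0<½* 0<ε)
  in M ℕ.⊔ N , λ n n≥ →
    ∣+∣< (seq x n ℚ.- seq y n) (seq u n ℚ.- seq v n) _
      (interchange (seq x n) (seq u n) (seq y n) (seq v n))
      (p n (ℕ.m⊔n≤o⇒m≤o M N n≥)) (q n (ℕ.m⊔n≤o⇒n≤o M N n≥))

+-0-commutativeMonoid : CommutativeMonoid 0ℓ 0ℓ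
+-0-commutativeMonoid = record
  { Carrier = ℝ ; _≈_ = _≈_ ; _∙_ = _+_ ; ε = 0ℝ
  ; isCommutativeMonoid = record
    { isMonoid = record
      { isSemigroup = record
        { isMagma = record
          { isEquivalence = record { refl = ≈-refl ; sym = ≈-sym ; trans = ≈-trans }
          ; ∙-cong = +-cong
          }
        ; assoc = λ x y z → ≗⇒≈ λ n → ℚ.+-assoc (seq x n) (seq y n) (seq z n)
        }
      ; identity = (λ x → ≗⇒≈ λ n → ℚ.+-identityˡ (seq x n))
                 , (λ x → ≗⇒≈ λ n → ℚ.+-identityʳ (seq x n))
      }
    ; comm = λ x y → ≗⇒≈ λ n → ℚ.+-comm (seq x n) (seq y n)
    }
  }

module ℝΣ = Sum +-0-commutativeMonoid
module ℤΣ = Sum ℤ.+-0-commutativeMonoid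

------------------------------------------------------------------------
-- Integer vectors and lattices

ℤVec : ℕ → Set
ℤVec n = Vector ℤ n

_-ᵛ_ : ∀ {n} → ℤVec n → ℤVec n → ℤVec n
(x -ᵛ y) j = x j ℤ.- y j

module _ {n k : ℕ} where

  ℝ-combination : Vector ℝ k → Vector (ℤVec n) k → Vector ℝ n
  ℝ-combination c v j = ℝΣ.sum λ i → c i · v i j

  ℤ-combination : Vector ℤ k → Vector (ℤVec n) k → ℤVec n
  ℤ-combination c v j = ℤΣ.sum λ i → c i ℤ.* v i j

  LinearlyIndependent : Vector (ℤVec n) k → Set
  LinearlyIndependent v =
    ∀ c → (∀ j → ℝ-combination c v j ≈ 0ℝ) → ∀ i → c i ≈ 0ℝ

  -- ℤⁿ ∩ span_ℝ(v₁,…,v_k)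
  Γ : Vector (ℤVec n) k → Pred (ℤVec n) 0ℓ
  Γ v x = ∃[ c ] ∀ j → fromℤ (x j) ≈ ℝ-combination c v j

  -- ℤv₁ + ⋯ + ℤv_k
  ℤ-span : Vector (ℤVec n) k → Pred (ℤVec n) 0ℓ
  ℤ-span v x = ∃[ c ] ∀ j → x j ≡ ℤ-combination c v j

  record IsℤBasis (L : Pred (ℤVec n) 0ℓ) (e : Vector (ℤVec n) k) : Set where
    field
      member      : ∀ i → e i ∈ L
      generates   : ∀ x → x ∈ L → x ∈ ℤ-span e
      independent : ∀ c → (∀ j → ℤ-combination c e j ≡ + 0) → ∀ i → c i ≡ + 0

Primitive : ∀ {n} → ℤVec n → Set
Primitive x = ∀ d → (∀ j → d ℤ.∣ x j) → ℤ.∣ d ∣ ≡ 1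

-- [ L ∶ M ] = m, for a subgroup M of L: a system of representatives of
-- the cosets of M in L, indexed without repetition by Fin m.
record HasIndex {n} (L M : Pred (ℤVec n) 0ℓ) (m : ℕ) : Set where
  field
    rep      : Fin m → ℤVec n
    member   : ∀ i → rep i ∈ L
    covers   : ∀ x → x ∈ L → ∃[ i ] (x -ᵛ rep i) ∈ M
    distinct : ∀ i j → (rep i -ᵛ rep j) ∈ M → i ≡ j

------------------------------------------------------------------------
-- Cones

-- An ordered rational k-cone in ℝⁿ.
record Cone (n k : ℕ) : Set where
  field
    k≤n           : k ℕ.≤ n
    vertex        : ℤVec n
    edge          : Vector (ℤVec n) k
    independent   : LinearlyIndependent edge
    primitiveEdge : ∀ i → Primitive (edge i)

open Cone public

private
  independent-remove : ∀ {n k} (v : Vector (ℤVec n) (suc k)) i₀ →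
    LinearlyIndependent v → LinearlyIndependent (removeAt v i₀)
  independent-remove v i₀ ind c c≈0 i =
    subst (_≈ 0ℝ) (insertAt-punchIn c i₀ 0ℝ i) (ind c′ c′≈0 (punchIn i₀ i))
    where
    open CommutativeMonoid +-0-commutativeMonoid using (setoid; identityˡ)
    open import Relation.Binary.Reasoning.Setoid setoid
    c′ = insertAt c i₀ 0ℝ
    c′≈0 : ∀ j → ℝ-combination c′ v j ≈ 0ℝ
    c′≈0 j = begin
      ℝ-combination c′ v j
        ≈⟨ ℝΣ.sum-remove {i = i₀} (λ l → c′ l · v l j) ⟩
      c′ i₀ · v i₀ j + ℝ-combination (removeAt c′ i₀) (removeAt v i₀) j
        ≡⟨ cong₂ _+_ (cong (_· v i₀ j) (insertAt-lookup c i₀ 0ℝ))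
             (ℝΣ.sum-cong-≗ λ l → cong (_· v (punchIn i₀ l) j) (insertAt-punchIn c i₀ 0ℝ l)) ⟩
      0ℝ · v i₀ j + ℝ-combination c (removeAt v i₀) j
        ≈⟨ +-cong (≗⇒≈ λ _ → ℚ.*-zeroˡ (v i₀ j ℚ./ 1)) ≈-refl ⟩
      0ℝ + ℝ-combination c (removeAt v i₀) j
        ≈⟨ identityˡ _ ⟩
      ℝ-combination c (removeAt v i₀) j
        ≈⟨ c≈0 j ⟩
      0ℝ ∎

  independent-permute : ∀ {n k} (v : Vector (ℤVec n) k) (s : Permutation′ k) →
    LinearlyIndependent v → LinearlyIndependent (v ∘ (s ⟨$⟩ʳ_))
  independent-permute v s ind c c≈0 i =
    subst (λ l → c l ≈ 0ℝ) (inverseˡ s) (ind c′ c′≈0 (s ⟨$⟩ʳ i))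
    where
    open CommutativeMonoid +-0-commutativeMonoid using (setoid)
    open import Relation.Binary.Reasoning.Setoid setoid
    c′ = c ∘ (s ⟨$⟩ˡ_)
    c′≈0 : ∀ j → ℝ-combination c′ v j ≈ 0ℝ
    c′≈0 j = begin
      ℝ-combination c′ v j
        ≈⟨ ℝΣ.sum-permute (λ l → c′ l · v l j) s ⟩
      ℝ-combination (c′ ∘ (s ⟨$⟩ʳ_)) (v ∘ (s ⟨$⟩ʳ_)) j
        ≡⟨ ℝΣ.sum-cong-≗ (λ l → cong (λ m → c m · v (s ⟨$⟩ʳ l) j) (inverseˡ s)) ⟩
      ℝ-combination c (v ∘ (s ⟨$⟩ʳ_)) j
        ≈⟨ c≈0 j ⟩
      0ℝ ∎

-- The facet generated by all edge vectors except the i-th.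
facet : ∀ {n k} → Cone n (suc k) → Fin (suc k) → Cone n k
facet α i = record
  { k≤n           = ℕ.≤-trans (ℕ.n≤1+n _) (k≤n α)
  ; vertex        = vertex α
  ; edge          = removeAt (edge α) i
  ; independent   = independent-remove (edge α) i (independent α)
  ; primitiveEdge = λ j → primitiveEdge α (punchIn i j)
  }

-- The s-transpose α_s.
transposeBy : ∀ {n k} → Permutation′ k → Cone n k → Cone n k
transposeBy s α = record
  { k≤n           = k≤n α
  ; vertex        = vertex α
  ; edge          = λ i → edge α (s ⟨$⟩ʳ i)
  ; independent   = independent-permute (edge α) s (independent α)
  ; primitiveEdge = λ i → primitiveEdge α (s ⟨$⟩ʳ i)
  }

IsTransposition : ∀ {k} → Permutation′ k → Set
IsTransposition s = ∃₂ λ i j → i ≢ j × s Perm.≈ Perm.transpose i j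

------------------------------------------------------------------------
-- Integer sines

-- lsin(β) = m
HasLsin : ∀ {n k} → Cone n k → ℕ → Set
HasLsin β m = HasIndex (Γ (edge β)) (ℤ-span (edge β)) m

Simple : ∀ {n k} → Cone n (suc k) → Set
Simple α = ∀ i → HasLsin (facet α i) 1

-- The ℤ-basis of Γ adapted to the ordered edge vectors, together with its
-- coefficients a j i.  Setting a j i = 0 for j > i makes the expansion of
-- v_i over j ≤ i a combination of the whole basis.
record HermiteBasis {n k} (α : Cone n k) : Set where
  field
    e        : Vector (ℤVec n) k
    isBasis  : IsℤBasis (Γ (edge α)) e
    a        : Fin k → Fin k → ℤ
    upper    : ∀ j i → i Fin.< j → a j i ≡ + 0
    expand   : ∀ i l → edge α i l ≡ ℤ-combination (λ j → a j i) e l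
    diagonal : ∀ i → + 0 ℤ.< a i i
    reduced  : ∀ j i → j Fin.< i → + 0 ℤ.≤ a j i × a j i ℤ.< a i i

-- lsin_i α.  Classically every α has exactly one Hermite basis, so this is
-- a function of α; neither existence nor uniqueness is proved here.
lsin : ∀ {n k} {α : Cone n k} → HermiteBasis α → Fin k → ℤ
lsin H i = HermiteBasis.a H i i

{-# OPTIONS --safe #-}
-- The k-th integer sine a_kk is the exponent of Γ / (ℤv₁ + ⋯ + ℤv_k), which does
-- not depend on the order of the edge vectors.  Simplicity makes v₁, …, v_{k-1}
-- generate the integer points of the facet they span, so e₁, …, e_{k-1} are integer
-- combinations of them; then a_kk e_k = v_k - Σ_{j<k} a_jk e_j shows that a_kk
-- annihilates the quotient.  Conversely the e_k-coordinate of every element of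
-- ℤv₁ + ⋯ + ℤv_k is a multiple of a_kk, so d e_k lies there only if a_kk divides d.
module Submission where

open import Defs
open import Algebra.Bundles using (CommutativeMonoid; CommutativeRing)
import Algebra.Properties.Semiring.Sum as SemiringSum
open import Data.Fin using (Fin; zero; suc; fromℕ; punchIn; punchOut; _<_)
open import Data.Fin.Induction using (<-wellFounded)
open import Data.Fin.Permutation
  using (Permutation′; _⟨$⟩ʳ_; inverseʳ; flip; remove; punchIn-permute)
open import Data.Fin.Properties
  using (<-cmp; <-trans; <⇒≢; ≤fromℕ; ≤∧≢⇒<; punchIn-punchOut; punchInᵢ≢i; _≟_)
open import Data.Integer as ℤ using (ℤ; +_; +[1+_])
open import Data.Integer.Divisibility.Signed using (_∣_; divides; ∣⇒∣ᵤ; ∣-reflexive; ∣m∣n⇒∣m+n; ∣n⇒∣m*n)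
import Data.Integer.Properties as ℤ
open import Data.Integer.Tactic.RingSolver using (solve-∀)
open import Data.Nat as ℕ using (ℕ; suc; _≤_)
import Data.Nat.Divisibility as ℕ
open import Data.Product using (_×_; _,_; ∃-syntax)
open import Data.Rational as ℚ using (1ℚ)
import Data.Rational.Properties as ℚ
import Data.Rational.Unnormalised as ℚᵘ
import Data.Rational.Unnormalised.Properties as ℚᵘ
open import Data.Vec.Functional using (Vector; insertAt; removeAt)
open import Data.Vec.Functional.Properties using (insertAt-lookup; insertAt-punchIn)
open import Function using (_∘_; case_of_)
open import Induction.WellFounded using (Acc; acc)
open import Level using (0ℓ)
open import Relation.Binary using (tri<; tri≈; tri>)
open import Relation.Binary.PropositionalEquality hiding (resp)
open import Relation.Nullary using (yes; no; contradiction)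
open import Relation.Unary using (Pred; _∈_; _⊆_)

module ℤ-Sum = SemiringSum ℤ.+-*-semiring
module ℚ-Sum = SemiringSum (CommutativeRing.semiring ℚ.+-*-commutativeRing)

private
  variable
    n k : ℕ

-- Submodules of ℤⁿ and integer combinations

infixl 6 _⊞_
infixr 7 _⊡_

_⊞_ : ℤVec n → ℤVec n → ℤVec n
(x ⊞ y) l = x l ℤ.+ y l

_⊡_ : ℤ → ℤVec n → ℤVec n
(z ⊡ x) l = z ℤ.* x l

-- Vectors are functions, so `resp` stands in for function extensionality. The abstraction serves
-- both `ℤ-span` and `DivisibleAt`.
record IsSubmodule (P : Pred (ℤVec n) 0ℓ) : Set where
  field
    resp     : ∀ {x y} → x ≗ y → x ∈ P → y ∈ P
    0-closed : (λ _ → + 0) ∈ P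
    +-closed : ∀ {x y} → x ∈ P → y ∈ P → x ⊞ y ∈ P
    *-closed : ∀ z {x} → x ∈ P → z ⊡ x ∈ P

  0*-closed : ∀ {z} x → z ≡ + 0 → z ⊡ x ∈ P
  0*-closed x refl = resp (λ l → sym (ℤ.*-zeroˡ (x l))) 0-closed

  -- Membership is asked of the products `c i ⊡ w i`, so a vector with coefficient 0 may itself lie
  -- outside `P`.
  combination-closed : (c : Vector ℤ k) (w : Vector (ℤVec n) k) →
    (∀ i → c i ⊡ w i ∈ P) → ℤ-combination c w ∈ P
  combination-closed {k = ℕ.zero} c w cw∈P = 0-closed
  combination-closed {k = suc _}  c w cw∈P =
    +-closed (cw∈P zero) (combination-closed (c ∘ suc) (w ∘ suc) (cw∈P ∘ suc))

  span⊆ : (w : Vector (ℤVec n) k) → (∀ i → w i ∈ P) → ℤ-span w ⊆ P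
  span⊆ w w∈P (c , x≡) =
    resp (sym ∘ x≡) (combination-closed c w λ i → *-closed (c i) (w∈P i))

ℤ-combination-0 : (w : Vector (ℤVec n) k) → ∀ l → + 0 ≡ ℤ-combination (λ _ → + 0) w l
ℤ-combination-0 w l = trans (sym (ℤ.*-zeroˡ (ℤΣ.sum (λ i → w i l)))) (ℤ-Sum.*-distribˡ-sum (+ 0) (λ i → w i l))

ℤ-combination-+ : (c d : Vector ℤ k) (w : Vector (ℤVec n) k) → ∀ l →
  ℤ-combination c w l ℤ.+ ℤ-combination d w l ≡ ℤ-combination (λ i → c i ℤ.+ d i) w l
ℤ-combination-+ c d w l = trans
  (sym (ℤΣ.∑-distrib-+ (λ i → c i ℤ.* w i l) (λ i → d i ℤ.* w i l)))
  (ℤΣ.sum-cong-≗ λ i → sym (ℤ.*-distribʳ-+ (w i l) (c i) (d i)))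

ℤ-combination-* : ∀ z (c : Vector ℤ k) (w : Vector (ℤVec n) k) → ∀ l →
  z ℤ.* ℤ-combination c w l ≡ ℤ-combination (λ i → z ℤ.* c i) w l
ℤ-combination-* z c w l = trans
  (ℤ-Sum.*-distribˡ-sum z (λ i → c i ℤ.* w i l))
  (ℤΣ.sum-cong-≗ λ i → sym (ℤ.*-assoc z (c i) (w i l)))

ℤ-combination-single : (w : Vector (ℤVec n) (suc k)) → ∀ i z l →
  z ℤ.* w i l ≡ ℤ-combination (insertAt (λ _ → + 0) i z) w l
ℤ-combination-single w i z l = sym (begin
  ℤ-combination δ w l
    ≡⟨ ℤΣ.sum-remove {i = i} (λ j → δ j ℤ.* w j l) ⟩
  δ i ℤ.* w i l ℤ.+ ℤ-combination (δ ∘ punchIn i) (w ∘ punchIn i) l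
    ≡⟨ cong₂ ℤ._+_ (cong (ℤ._* w i l) (insertAt-lookup _ i z))
         (ℤΣ.sum-cong-≗ λ j → cong (ℤ._* w (punchIn i j) l) (insertAt-punchIn _ i z j)) ⟩
  z ℤ.* w i l ℤ.+ ℤ-combination (λ _ → + 0) (w ∘ punchIn i) l
    ≡⟨ cong (λ u → z ℤ.* w i l ℤ.+ u) (ℤ-combination-0 (w ∘ punchIn i) l) ⟨
  z ℤ.* w i l ℤ.+ + 0
    ≡⟨ ℤ.+-identityʳ _ ⟩
  z ℤ.* w i l ∎)
  where
  open ≡-Reasoning
  δ = insertAt (λ _ → + 0) i z

-- When `w` is a basis, `c` is unique and this is the preimage of dℤ under the `i`-th coordinate
-- map. Asking only for some `c` gives a submodule for every `w`.
DivisibleAt : Vector (ℤVec n) k → Fin k → ℤ → Pred (ℤVec n) 0ℓ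
DivisibleAt w i d x = ∃[ c ] (∀ l → x l ≡ ℤ-combination c w l) × d ∣ c i

DivisibleAt-isSubmodule : (w : Vector (ℤVec n) k) → ∀ i d → IsSubmodule (DivisibleAt w i d)
DivisibleAt-isSubmodule w i d = record
  { resp     = λ { x≗y (c , x≡ , d∣c) → c , (λ l → trans (sym (x≗y l)) (x≡ l)) , d∣c }
  ; 0-closed = (λ _ → + 0) , ℤ-combination-0 w , divides (+ 0) refl
  ; +-closed = λ { (c , x≡ , d∣c) (c′ , y≡ , d∣c′) →
      (λ j → c j ℤ.+ c′ j) ,
      (λ l → trans (cong₂ ℤ._+_ (x≡ l) (y≡ l)) (ℤ-combination-+ c c′ w l)) ,
      ∣m∣n⇒∣m+n d∣c d∣c′ }
  ; *-closed = λ { z (c , x≡ , d∣c) →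
      (λ j → z ℤ.* c j) ,
      (λ l → trans (cong (z ℤ.*_) (x≡ l)) (ℤ-combination-* z c w l)) ,
      ∣n⇒∣m*n z d∣c }
  }

ℤ-span-isSubmodule : (w : Vector (ℤVec n) k) → IsSubmodule (ℤ-span w)
ℤ-span-isSubmodule w = record
  { resp     = λ { x≗y (c , x≡) → c , λ l → trans (sym (x≗y l)) (x≡ l) }
  ; 0-closed = (λ _ → + 0) , ℤ-combination-0 w
  ; +-closed = λ { (c , x≡) (d , y≡) →
      (λ i → c i ℤ.+ d i) , λ l → trans (cong₂ ℤ._+_ (x≡ l) (y≡ l)) (ℤ-combination-+ c d w l) }
  ; *-closed = λ { z (c , x≡) →
      (λ i → z ℤ.* c i) , λ l → trans (cong (z ℤ.*_) (x≡ l)) (ℤ-combination-* z c w l) }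
  }

generator∈ℤ-span : (w : Vector (ℤVec n) k) → ∀ i → w i ∈ ℤ-span w
generator∈ℤ-span {k = suc _} w i =
  insertAt (λ _ → + 0) i (+ 1) ,
  λ l → trans (sym (ℤ.*-identityˡ (w i l))) (ℤ-combination-single w i (+ 1) l)

ℤ-basis-injective : ∀ {L} {e : Vector (ℤVec n) k} → IsℤBasis L e → ∀ c d →
  ℤ-combination c e ≗ ℤ-combination d e → c ≗ d
ℤ-basis-injective {e = e} basis c d eq i =
  ℤ.i-j≡0⇒i≡j (c i) (d i) (trans (cong (λ u → c i ℤ.+ u) (sym (ℤ.-1*i≡-i (d i))))
    (IsℤBasis.independent basis (λ j → c j ℤ.+ ℤ.-1ℤ ℤ.* d j) c-d≡0 i))
  where
  open ≡-Reasoning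
  c-d≡0 : ∀ l → ℤ-combination (λ j → c j ℤ.+ ℤ.-1ℤ ℤ.* d j) e l ≡ + 0
  c-d≡0 l = begin
    ℤ-combination (λ j → c j ℤ.+ ℤ.-1ℤ ℤ.* d j) e l
      ≡⟨ ℤ-combination-+ c (λ j → ℤ.-1ℤ ℤ.* d j) e l ⟨
    ℤ-combination c e l ℤ.+ ℤ-combination (λ j → ℤ.-1ℤ ℤ.* d j) e l
      ≡⟨ cong₂ ℤ._+_ (eq l) (sym (ℤ-combination-* ℤ.-1ℤ d e l)) ⟩
    ℤ-combination d e l ℤ.+ ℤ.-1ℤ ℤ.* ℤ-combination d e l
      ≡⟨ cong (λ u → ℤ-combination d e l ℤ.+ u) (ℤ.-1*i≡-i (ℤ-combination d e l)) ⟩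
    ℤ-combination d e l ℤ.- ℤ-combination d e l
      ≡⟨ ℤ.+-inverseʳ (ℤ-combination d e l) ⟩
    + 0 ∎

-- Integer points of a real span

/1-* : ∀ a b → (a ℤ.* b) ℚ./ 1 ≡ (a ℚ./ 1) ℚ.* (b ℚ./ 1)
-- Division on ℚ reduces by a gcd; on unnormalised fractions the identity is immediate.
/1-* a b = ℚ.toℚᵘ-injective (begin
  ℚ.toℚᵘ ((a ℤ.* b) ℚ./ 1)                  ≈⟨ ℚ.toℚᵘ-fromℚᵘ (ℚᵘ.mkℚᵘ (a ℤ.* b) 0) ⟩
  ℚᵘ.mkℚᵘ a 0 ℚᵘ.* ℚᵘ.mkℚᵘ b 0
    ≈⟨ ℚᵘ.*-cong (ℚ.toℚᵘ-fromℚᵘ (ℚᵘ.mkℚᵘ a 0)) (ℚ.toℚᵘ-fromℚᵘ (ℚᵘ.mkℚᵘ b 0)) ⟨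
  ℚ.toℚᵘ (a ℚ./ 1) ℚᵘ.* ℚ.toℚᵘ (b ℚ./ 1)    ≈⟨ ℚ.toℚᵘ-homo-* (a ℚ./ 1) (b ℚ./ 1) ⟨
  ℚ.toℚᵘ ((a ℚ./ 1) ℚ.* (b ℚ./ 1))          ∎)
  where open ℚᵘ.≃-Reasoning

/1-+ : ∀ a b → (a ℤ.+ b) ℚ./ 1 ≡ (a ℚ./ 1) ℚ.+ (b ℚ./ 1)
/1-+ a b = ℚ.toℚᵘ-injective (begin
  ℚ.toℚᵘ ((a ℤ.+ b) ℚ./ 1)                  ≈⟨ ℚ.toℚᵘ-fromℚᵘ (ℚᵘ.mkℚᵘ (a ℤ.+ b) 0) ⟩
  ℚᵘ.mkℚᵘ (a ℤ.+ b) 0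
    ≡⟨ cong (λ z → ℚᵘ.mkℚᵘ z 0) (cong₂ ℤ._+_ (ℤ.*-identityʳ a) (ℤ.*-identityʳ b)) ⟨
  ℚᵘ.mkℚᵘ a 0 ℚᵘ.+ ℚᵘ.mkℚᵘ b 0
    ≈⟨ ℚᵘ.+-cong (ℚ.toℚᵘ-fromℚᵘ (ℚᵘ.mkℚᵘ a 0)) (ℚ.toℚᵘ-fromℚᵘ (ℚᵘ.mkℚᵘ b 0)) ⟨
  ℚ.toℚᵘ (a ℚ./ 1) ℚᵘ.+ ℚ.toℚᵘ (b ℚ./ 1)    ≈⟨ ℚ.toℚᵘ-homo-+ (a ℚ./ 1) (b ℚ./ 1) ⟨
  ℚ.toℚᵘ ((a ℚ./ 1) ℚ.+ (b ℚ./ 1))          ∎)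
  where open ℚᵘ.≃-Reasoning

/1-sum : (f : Vector ℤ k) → ℤΣ.sum f ℚ./ 1 ≡ ℚ-Sum.sum (λ i → f i ℚ./ 1)
/1-sum {ℕ.zero} f = refl
/1-sum {suc _}  f = trans (/1-+ (f zero) _) (cong ((f zero ℚ./ 1) ℚ.+_) (/1-sum (f ∘ suc)))

seq-sum : (f : Vector ℝ k) → ∀ m → seq (ℝΣ.sum f) m ≡ ℚ-Sum.sum (λ i → seq (f i) m)
seq-sum {ℕ.zero} f m = refl
seq-sum {suc _}  f m = cong (seq (f zero) m ℚ.+_) (seq-sum (f ∘ suc) m)

1/a*a≡1 : ∀ m → (+ 1 ℚ./ suc m) ℚ.* (+[1+ m ] ℚ./ 1) ≡ 1ℚ
1/a*a≡1 m = ℚ.toℚᵘ-injective (begin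
  ℚ.toℚᵘ ((+ 1 ℚ./ suc m) ℚ.* (+[1+ m ] ℚ./ 1))
    ≈⟨ ℚ.toℚᵘ-homo-* (+ 1 ℚ./ suc m) (+[1+ m ] ℚ./ 1) ⟩
  ℚ.toℚᵘ (+ 1 ℚ./ suc m) ℚᵘ.* ℚ.toℚᵘ (+[1+ m ] ℚ./ 1)
    ≈⟨ ℚᵘ.*-cong (ℚ.toℚᵘ-fromℚᵘ (ℚᵘ.mkℚᵘ (+ 1) m)) (ℚ.toℚᵘ-fromℚᵘ (ℚᵘ.mkℚᵘ +[1+ m ] 0)) ⟩
  ℚᵘ.mkℚᵘ (+ 1) m ℚᵘ.* ℚᵘ.mkℚᵘ +[1+ m ] 0
    ≈⟨ ℚᵘ.*-inverseˡ (ℚᵘ.mkℚᵘ +[1+ m ] 0) ⟩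
  ℚ.toℚᵘ 1ℚ ∎)
  where open ℚᵘ.≃-Reasoning

-- The coefficients `c i` divided by `a` are rational, hence constant Cauchy sequences, and the
-- required equality of reals holds term by term.
multiple∈ℤ-span⇒∈Γ : (w : Vector (ℤVec n) k) → ∀ a x → + 0 ℤ.< a → a ⊡ x ∈ ℤ-span w → x ∈ Γ w
multiple∈ℤ-span⇒∈Γ w +[1+ m ] x _ (c , ax≡) =
  (λ i → fromℚ (q ℚ.* (c i ℚ./ 1))) , λ l → ≗⇒≈ λ p → begin
    x l ℚ./ 1
      ≡⟨ ℚ.*-identityˡ _ ⟨
    1ℚ ℚ.* (x l ℚ./ 1)
      ≡⟨ cong (ℚ._* (x l ℚ./ 1)) (1/a*a≡1 m) ⟨
    q ℚ.* (a ℚ./ 1) ℚ.* (x l ℚ./ 1)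
      ≡⟨ ℚ.*-assoc q (a ℚ./ 1) (x l ℚ./ 1) ⟩
    q ℚ.* ((a ℚ./ 1) ℚ.* (x l ℚ./ 1))
      ≡⟨ cong (q ℚ.*_) (/1-* a (x l)) ⟨
    q ℚ.* ((a ℤ.* x l) ℚ./ 1)
      ≡⟨ cong (λ z → q ℚ.* (z ℚ./ 1)) (ax≡ l) ⟩
    q ℚ.* (ℤ-combination c w l ℚ./ 1)
      ≡⟨ cong (q ℚ.*_) (/1-sum (λ i → c i ℤ.* w i l)) ⟩
    q ℚ.* ℚ-Sum.sum (λ i → (c i ℤ.* w i l) ℚ./ 1)
      ≡⟨ ℚ-Sum.*-distribˡ-sum q (λ i → (c i ℤ.* w i l) ℚ./ 1) ⟩
    ℚ-Sum.sum (λ i → q ℚ.* ((c i ℤ.* w i l) ℚ./ 1))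
      ≡⟨ ℚ-Sum.sum-cong-≗ (λ i → trans (cong (q ℚ.*_) (/1-* (c i) (w i l)))
           (sym (ℚ.*-assoc q (c i ℚ./ 1) (w i l ℚ./ 1)))) ⟩
    ℚ-Sum.sum (λ i → q ℚ.* (c i ℚ./ 1) ℚ.* (w i l ℚ./ 1))
      ≡⟨ seq-sum (λ i → fromℚ (q ℚ.* (c i ℚ./ 1)) · w i l) p ⟨
    seq (ℝ-combination (λ i → fromℚ (q ℚ.* (c i ℚ./ 1))) w l) p ∎
  where
  open ≡-Reasoning
  a = +[1+ m ]
  q = + 1 ℚ./ suc m
multiple∈ℤ-span⇒∈Γ w (+ 0) x (ℤ.+<+ ()) _

-- The form in which simplicity is applied: the `w i` generate every integer point of their real
-- span.
Saturated : Vector (ℤVec n) k → Set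
Saturated w = Γ w ⊆ ℤ-span w

0∈Γ : (w : Vector (ℤVec n) k) → (λ _ → + 0) ∈ Γ w
0∈Γ w = multiple∈ℤ-span⇒∈Γ w (+ 1) (λ _ → + 0) (ℤ.+<+ ℕ.z<s)
  (*-closed (+ 1) {λ _ → + 0} 0-closed)
  where open IsSubmodule (ℤ-span-isSubmodule w)

-- The single representative r may be nonzero. Covering 0 as well puts 0 - r in the span, and x = (x
-- - r) - (0 - r).
index1⇒saturated : (w : Vector (ℤVec n) k) → HasIndex (Γ w) (ℤ-span w) 1 → Saturated w
index1⇒saturated w index {x} x∈Γ
  with zero , x-r∈ ← HasIndex.covers index x x∈Γ
     | zero , 0-r∈ ← HasIndex.covers index (λ _ → + 0) (0∈Γ w) =
  resp (λ l → cancel (x l) (rep zero l)) (+-closed x-r∈ (*-closed ℤ.-1ℤ {(λ _ → + 0) -ᵛ rep zero} 0-r∈))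
  where
  open IsSubmodule (ℤ-span-isSubmodule w)
  open HasIndex index using (rep)
  cancel : ∀ x r → (x ℤ.- r) ℤ.+ ℤ.-1ℤ ℤ.* (+ 0 ℤ.- r) ≡ x
  cancel = solve-∀

-- Reordering the generators

Γ-permute : (v w : Vector (ℤVec n) k) (π : Permutation′ k) →
  (∀ i → w i ≡ v (π ⟨$⟩ʳ i)) → Γ v ⊆ Γ w
Γ-permute v w π w≡ (c , x≈) = c ∘ (π ⟨$⟩ʳ_) , λ l →
  ≈-trans (x≈ l) (≈-trans (ℝΣ.sum-permute (λ i → c i · v i l) π)
    (reflexive (ℝΣ.sum-cong-≗ λ i → cong (λ u → c (π ⟨$⟩ʳ i) · u l) (sym (w≡ i)))))
  where open CommutativeMonoid +-0-commutativeMonoid using (reflexive)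

ℤ-span-permute : (v w : Vector (ℤVec n) k) (π : Permutation′ k) →
  (∀ i → w i ≡ v (π ⟨$⟩ʳ i)) → ℤ-span w ⊆ ℤ-span v
ℤ-span-permute v w π w≡ = span⊆ w λ i →
  subst (_∈ ℤ-span v) (sym (w≡ i)) (generator∈ℤ-span v (π ⟨$⟩ʳ i))
  where open IsSubmodule (ℤ-span-isSubmodule v)

-- Exchanges the roles of `v` and `w`, so each inclusion above also yields its converse.
permute-inverse : (v w : Vector (ℤVec n) k) (π : Permutation′ k) →
  (∀ i → w i ≡ v (π ⟨$⟩ʳ i)) → ∀ i → v i ≡ w (flip π ⟨$⟩ʳ i)
permute-inverse v w π w≡ i = sym (trans (w≡ _) (cong v (inverseʳ π)))

saturated-permute : (v w : Vector (ℤVec n) k) (π : Permutation′ k) →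
  (∀ i → w i ≡ v (π ⟨$⟩ʳ i)) → Saturated v → Saturated w
saturated-permute v w π w≡ sat {x} x∈Γw = ℤ-span-permute w v (flip π) v≡ {x}
  (sat {x} (Γ-permute w v (flip π) v≡ {x} x∈Γw))
  where v≡ = permute-inverse v w π w≡

-- The last diagonal entry as an exponent

module _ {α : Cone n (suc k)} (H : HermiteBasis α) where
  open HermiteBasis H

  private
    last = fromℕ k
    v    = edge α

  -- Solve the triangular expansion of `v i` for its diagonal term: the terms with `j > i` vanish
  -- and those with `j < i` lie in `P`. It is applied to the span of the facet and to the full span.
  diagonal-multiple∈ : ∀ {P} → IsSubmodule P → ∀ i →
    v i ∈ P → (∀ j → j < i → e j ∈ P) → a i i ⊡ e i ∈ P
  diagonal-multiple∈ {P} isSub i v∈P e∈P =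
    resp (λ l → sym (isolate l)) (+-closed v∈P (*-closed ℤ.-1ℤ {rest} rest∈P))
    where
    open IsSubmodule isSub
    rest : ℤVec n
    rest = ℤ-combination (λ j → a (punchIn i j) i) (e ∘ punchIn i)
    rest∈P : rest ∈ P
    rest∈P = combination-closed (λ j → a (punchIn i j) i) (e ∘ punchIn i) λ j →
      case <-cmp (punchIn i j) i of λ where
      (tri< p<i _ _) → *-closed (a (punchIn i j) i) (e∈P (punchIn i j) p<i)
      (tri≈ _ p≡i _) → contradiction p≡i (punchInᵢ≢i i j)
      (tri> _ _ i<p) → 0*-closed (e (punchIn i j)) (upper (punchIn i j) i i<p)
    cancel : ∀ x y → x ≡ (x ℤ.+ y) ℤ.+ ℤ.-1ℤ ℤ.* y
    cancel = solve-∀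
    isolate : ∀ l → a i i ℤ.* e i l ≡ v i l ℤ.+ ℤ.-1ℤ ℤ.* rest l
    isolate l = trans (cancel _ (rest l)) (cong (ℤ._+ ℤ.-1ℤ ℤ.* rest l)
      (sym (trans (expand i l) (ℤΣ.sum-remove {i = i} (λ j → a j i ℤ.* e j l)))))

  -- It suffices to multiply each basis vector. Only `e last` needs the factor; the earlier ones
  -- already lie in the span of the facet vectors.
  lsin-annihilates : Saturated (removeAt v last) → ∀ x → x ∈ Γ v → lsin H last ⊡ x ∈ ℤ-span v
  lsin-annihilates sat x x∈Γ = let c , x≡ = IsℤBasis.generates isBasis x x∈Γ in
    resp (λ l → sym (trans (cong (a last last ℤ.*_) (x≡ l)) (ℤ-combination-* (a last last) c e l)))
      (combination-closed (λ j → a last last ℤ.* c j) e λ j →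
        resp (swap (c j) j) (*-closed (c j) {a last last ⊡ e j} (ae∈ j)))
    where
    open IsSubmodule (ℤ-span-isSubmodule v)
    facet-vector : ∀ {i} → last ≢ i → v i ∈ ℤ-span (removeAt v last)
    facet-vector {i} last≢i = subst (λ j → v j ∈ ℤ-span (removeAt v last))
      (punchIn-punchOut last≢i) (generator∈ℤ-span (removeAt v last) (punchOut last≢i))
    -- Induction on `j`: triangularity puts `a j j ⊡ e j` in the facet span, dividing by `a j j`
    -- leaves `e j` in the facet's Γ, and saturation returns it to the integer span.
    facet-basis : ∀ j → Acc _<_ j → j < last → e j ∈ ℤ-span (removeAt v last)
    facet-basis j (acc rec) j<last = sat {e j} (multiple∈ℤ-span⇒∈Γ _ (a j j) (e j) (diagonal j)
      (diagonal-multiple∈ (ℤ-span-isSubmodule (removeAt v last)) j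
        (facet-vector (≢-sym (<⇒≢ j<last)))
        (λ i i<j → facet-basis i (rec i<j) (<-trans i<j j<last))))
    e∈ : ∀ j → j < last → e j ∈ ℤ-span v
    e∈ j j<last = span⊆ (removeAt v last) (λ i → generator∈ℤ-span v (punchIn last i)) {e j}
      (facet-basis j (<-wellFounded j) j<last)
    ae∈ : ∀ j → a last last ⊡ e j ∈ ℤ-span v
    ae∈ j with j ≟ last
    ... | yes refl   = diagonal-multiple∈ (ℤ-span-isSubmodule v) last (generator∈ℤ-span v last) e∈
    ... | no  j≢last = *-closed (a last last) (e∈ j (≤∧≢⇒< (≤fromℕ j) j≢last))
    swap : ∀ c j l → c ℤ.* (a last last ℤ.* e j l) ≡ (a last last ℤ.* c) ℤ.* e j l
    swap c j l = comm c (a last last) (e j l)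
      where
      comm : ∀ x y z → x ℤ.* (y ℤ.* z) ≡ (y ℤ.* x) ℤ.* z
      comm = solve-∀

  -- Membership in `DivisibleAt` supplies some coordinates of `d ⊡ e last` whose last entry is a
  -- multiple of `a last last`; uniqueness of coordinates in the basis identifies that entry with
  -- `d`.
  lsin-divides : ∀ d → d ⊡ e last ∈ ℤ-span v → lsin H last ∣ d
  lsin-divides d de∈ = let c , de≡ , a∣c = span⊆ v v∈ {d ⊡ e last} de∈ in
    subst (a last last ∣_) (sym (trans (sym (insertAt-lookup (λ _ → + 0) last d))
      (ℤ-basis-injective isBasis (insertAt (λ _ → + 0) last d) c
        (λ l → trans (sym (ℤ-combination-single e last d l)) (de≡ l)) last))) a∣c
    where
    open IsSubmodule (DivisibleAt-isSubmodule e last (a last last))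
    v∈ : ∀ i → v i ∈ DivisibleAt e last (a last last)
    v∈ i = (λ j → a j i) , expand i , a∣
      where
      a∣ : a last last ∣ a last i
      a∣ with i ≟ last
      ... | yes refl   = ∣-reflexive refl
      -- In the last row every entry off the diagonal is 0.
      ... | no  i≢last = divides (+ 0) (upper last i (≤∧≢⇒< (≤fromℕ i) i≢last))

-- Comparing two orderings of the edges

lsin-last-∣ : {α β : Cone n (suc k)} (π : Permutation′ (suc k)) →
  (∀ i → edge β i ≡ edge α (π ⟨$⟩ʳ i)) →
  Saturated (removeAt (edge β) (fromℕ k)) →
  (H : HermiteBasis α) (K : HermiteBasis β) →
  lsin H (fromℕ k) ∣ lsin K (fromℕ k)
lsin-last-∣ {k = k} {α = α} {β} π β≡ sat H K =
  -- The last basis vector of `H` is an element of Γ for `β` too, so `d` carries it into the common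
  -- span of the edges.
  lsin-divides H d (ℤ-span-permute (edge α) (edge β) π β≡ {d ⊡ eₖ}
    (lsin-annihilates K sat eₖ (Γ-permute (edge α) (edge β) π β≡ {eₖ}
      (IsℤBasis.member (HermiteBasis.isBasis H) (fromℕ k)))))
  where
  d  = lsin K (fromℕ k)
  eₖ = HermiteBasis.e H (fromℕ k)

-- Mutual divisibility fixes the absolute values; positivity settles the signs.
∣-antisym-pos : ∀ {a b} → + 0 ℤ.< a → + 0 ℤ.< b → a ∣ b → b ∣ a → a ≡ b
∣-antisym-pos {+ _} {+ _} _ _ a∣b b∣a = cong +_ (ℕ.∣-antisym (∣⇒∣ᵤ a∣b) (∣⇒∣ᵤ b∣a))

proposition3p3 : (n k : ℕ) → 2 ≤ suc k →
    (α : Cone n (suc k)) → Simple α →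
    (s : Permutation′ (suc k)) → IsTransposition s →
    (H : HermiteBasis α) (Hₛ : HermiteBasis (transposeBy s α)) →
    lsin H (fromℕ k) ≡ lsin Hₛ (fromℕ k)
proposition3p3 n k _ α simple s _ H Hₛ =
  ∣-antisym-pos (HermiteBasis.diagonal H last) (HermiteBasis.diagonal Hₛ last)
    (lsin-last-∣ s (λ _ → refl) (saturatedₛ last) H Hₛ)
    (lsin-last-∣ (flip s) (permute-inverse v vₛ s (λ _ → refl)) (saturated last) Hₛ H)
  where
  last = fromℕ k
  v    = edge α
  vₛ   = edge (transposeBy s α)
  saturated : ∀ i → Saturated (removeAt v i)
  saturated i = index1⇒saturated (removeAt v i) (simple i)
  -- Omitting the `i`-th edge after reordering omits the original edge `s ⟨$⟩ʳ i`; `remove i s` is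
  -- the induced bijection of the remaining edges. Simplicity is thus used at a facet other than the
  -- last whenever `s` moves `last`.
  saturatedₛ : ∀ i → Saturated (removeAt vₛ i)
  saturatedₛ i = saturated-permute (removeAt v (s ⟨$⟩ʳ i)) (removeAt vₛ i) (remove i s)
    (λ j → cong v (punchIn-permute s i j)) (saturated (s ⟨$⟩ʳ i))
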